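{- For every positive integer $k$, as formal power series in $q$, $$\sum_{n\ge 1}\mathrm{spt}k_d(n)\,q^n=P_k(q)\,(-q;q)_\infty+(-1)^k (q;q)_{k-1},$$ where the polynomials $P_k(q)$ are defined by $P_1(q)=1$ and $P_k(q)=(q^{k-1}-1)P_{k-1}(q)+q^{k-1}$ for $k>1$.
   Context: For a partition $\pi$, $s(\pi)$ denotes its smallest part. $\mathrm{Spt}k_d(n)$ is the set of partitions $\pi$ of $n$ in which the smallest part $s(\pi)$ occurs exactly $k$ times and all remaining parts (those larger than $s(\pi)$) are pairwise distinct; $\mathrm{spt}k_d(n)=|\mathrm{Spt}k_d(n)|$. Notation: $(a;q)_0=1$, $(a;q)_n=\prod_{j=0}^{n-1}(1-aq^j)$, $(a;q)_\infty=\prod_{j\ge 0}(1-aq^j)$. -}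

module Defs where

open import Data.Fin.Base using (Fin; toℕ; zero; suc)
open import Data.Integer.Base as ℤ using (ℤ; 0ℤ; 1ℤ)
import Data.Integer.Properties as ℤₚ
open import Data.List.Base using (List; []; _∷_; _++_; map; filter; length)
open import Data.List.Extrema.Nat using (min)
open import Data.List.Membership.Propositional using (_∈_)
open import Data.List.Membership.Propositional.Properties using (∈-++⁺ˡ; ∈-++⁺ʳ; ∈-++⁻; ∈-map⁺; ∈-map⁻; ∈-filter⁺; ∈-filter⁻)
open import Data.List.Properties using (∷-injectiveʳ)
open import Data.List.Relation.Unary.All using (All; all?; []; _∷_)
open import Data.List.Relation.Unary.AllPairs using ([]; _∷_)
open import Data.List.Relation.Unary.Any using (here)
open import Data.List.Relation.Unary.Linked using (Linked; linked?)
open import Data.List.Relation.Unary.Unique.Propositional using (Unique)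
import Data.List.Relation.Unary.Unique.Propositional.Properties as Uniqueₚ
open import Data.Nat.Base as ℕ using (ℕ; zero; suc; _∸_; _<_; _≥_; NonZero; s≤s)
open import Data.Nat.ListAction using (sum)
open import Data.Nat.Properties as ℕₚ using (_≟_; _<?_; _≥?_)
open import Data.Product.Base using (_×_; _,_; proj₂; ∃-syntax)
open import Data.Sum.Base using (inj₁; inj₂)
open import Function.Base using (_∘_)
open import Function.Bundles using (_⇔_; mk⇔)
open import Relation.Binary.PropositionalEquality using (_≡_; refl; cong; trans)
open import Relation.Nullary using (Dec; yes; no; contradiction)
open import Relation.Nullary.Decidable using (_×-dec_)

import Algebra.Properties.CommutativeMonoid.Sum ℤₚ.+-0-commutativeMonoid as ℤ∑
open import Data.List.Relation.Unary.Unique.DecPropositional _≟_ using (unique?)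

IsPartition : ℕ → List ℕ → Set
IsPartition n π = All (0 <_) π × Linked _≥_ π × sum π ≡ n

-- s [] is a dummy value.
s : List ℕ → ℕ
s []      = 0
s (x ∷ π) = min x π

occurrences : ℕ → List ℕ → ℕ
occurrences m π = length (filter (m ≟_) π)

IsSptd : ℕ → ℕ → List ℕ → Set
IsSptd k n π =
  IsPartition n π ×
  occurrences (s π) π ≡ k ×
  Unique (filter (s π <?_) π)

isPartition? : ∀ n π → Dec (IsPartition n π)
isPartition? n π = all? (0 <?_) π ×-dec linked? _≥?_ π ×-dec sum π ≟ n

isSptd? : ∀ k n π → Dec (IsSptd k n π)
isSptd? k n π =
  isPartition? n π ×-dec occurrences (s π) π ≟ k ×-dec unique? (filter (s π <?_) π)

-- compositionsFrom a n lists the compositions of suc a + n whose first part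
-- is at least suc a.
compositionsFrom : ℕ → ℕ → List (List ℕ)
compositionsFrom a zero    = (suc a ∷ []) ∷ []
compositionsFrom a (suc n) =
  map (suc a ∷_) (compositionsFrom 0 n) ++ compositionsFrom (suc a) n

compositions : ℕ → List (List ℕ)
compositions zero    = [] ∷ []
compositions (suc n) = compositionsFrom 0 n

-- The finite set Sptk_d(n); ∈-Sptd⇔ and Sptd-unique below show that it
-- lists every π with IsSptd k n π exactly once.
Sptd : ℕ → ℕ → List (List ℕ)
Sptd k n = filter (isSptd? k n) (compositions n)

sptd : ℕ → ℕ → ℕ
sptd k n = length (Sptd k n)

private
  headFrom : ∀ a n {π} → π ∈ compositionsFrom a n → ∃[ x ] ∃[ ρ ] π ≡ x ∷ ρ × a < x
  headFrom a zero    (here refl) = suc a , [] , refl , ℕₚ.≤-refl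
  headFrom a (suc n) π∈ with ∈-++⁻ (map (suc a ∷_) (compositionsFrom 0 n)) π∈
  ... | inj₁ π∈ˡ with ∈-map⁻ (suc a ∷_) π∈ˡ
  ...   | ρ , _ , refl = suc a , ρ , refl , ℕₚ.≤-refl
  headFrom a (suc n) π∈ | inj₂ π∈ʳ with headFrom (suc a) n π∈ʳ
  ...   | x , ρ , eq , a<x = x , ρ , eq , ℕₚ.<-trans (ℕₚ.n<1+n a) a<x

  uniqueFrom : ∀ a n → Unique (compositionsFrom a n)
  uniqueFrom a zero    = [] ∷ []
  uniqueFrom a (suc n) =
    Uniqueₚ.++⁺ (Uniqueₚ.map⁺ ∷-injectiveʳ (uniqueFrom 0 n)) (uniqueFrom (suc a) n) disjoint
    where
    disjoint : ∀ {π} → π ∈ map (suc a ∷_) (compositionsFrom 0 n) × π ∈ compositionsFrom (suc a) n → _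
    disjoint (π∈ˡ , π∈ʳ) with ∈-map⁻ (suc a ∷_) π∈ˡ | headFrom (suc a) n π∈ʳ
    ... | _ , _ , refl | _ , _ , refl , a<a = ℕₚ.<-irrefl refl a<a

  completeFrom : ∀ a n {x π} → a < x → All (0 <_) π → sum (x ∷ π) ≡ suc a ℕ.+ n →
                 (x ∷ π) ∈ compositionsFrom a n
  completeFrom a n {x} a<x pos eq with suc a ≟ x
  completeFrom a zero    {x} {[]}    a<x pos eq | yes refl = here refl
  completeFrom a zero    {x} {y ∷ π} a<x (y>0 ∷ _) eq | yes refl =
    contradiction (ℕₚ.+-cancelˡ-≡ (suc a) _ _ eq)
      (ℕₚ.>⇒≢ (ℕₚ.<-≤-trans y>0 (ℕₚ.m≤m+n y (sum π))))
  completeFrom a (suc n) {x} {[]}    a<x pos eq | yes refl =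
    contradiction (ℕₚ.+-cancelˡ-≡ (suc a) _ _ eq) λ ()
  completeFrom a (suc n) {x} {y ∷ π} a<x (y>0 ∷ pos) eq | yes refl =
    ∈-++⁺ˡ (∈-map⁺ (suc a ∷_) (completeFrom 0 n y>0 pos (ℕₚ.+-cancelˡ-≡ (suc a) _ _ eq)))
  completeFrom a zero {x} {π} a<x pos eq | no a≢x =
    contradiction (trans eq (ℕₚ.+-identityʳ (suc a)))
      (ℕₚ.>⇒≢ (ℕₚ.<-≤-trans (ℕₚ.≤∧≢⇒< a<x a≢x) (ℕₚ.m≤m+n x (sum π))))
  completeFrom a (suc n) a<x pos eq | no a≢x =
    ∈-++⁺ʳ _ (completeFrom (suc a) n (ℕₚ.≤∧≢⇒< a<x a≢x) pos (trans eq (ℕₚ.+-suc (suc a) n)))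

  compositions-unique : ∀ n → Unique (compositions n)
  compositions-unique zero    = [] ∷ []
  compositions-unique (suc n) = uniqueFrom 0 n

  compositions-complete : ∀ n {π} → All (0 <_) π → sum π ≡ n → π ∈ compositions n
  compositions-complete zero    {[]}    _ _ = here refl
  compositions-complete zero    {x ∷ π} (x>0 ∷ _) eq =
    contradiction eq (ℕₚ.>⇒≢ (ℕₚ.<-≤-trans x>0 (ℕₚ.m≤m+n x (sum π))))
  compositions-complete (suc n) {x ∷ π} (x>0 ∷ pos) eq = completeFrom 0 n x>0 pos eq

∈-Sptd⇔ : ∀ k n {π} → π ∈ Sptd k n ⇔ IsSptd k n π
∈-Sptd⇔ k n = mk⇔
  (λ π∈ → proj₂ (∈-filter⁻ (isSptd? k n) {xs = compositions n} π∈))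
  (λ { p@((pos , _ , eq) , _) → ∈-filter⁺ (isSptd? k n) (compositions-complete n pos eq) p })

Sptd-unique : ∀ k n → Unique (Sptd k n)
Sptd-unique k n = Uniqueₚ.filter⁺ (isSptd? k n) (compositions-unique n)

ℤ⟦q⟧ : Set
ℤ⟦q⟧ = ℕ → ℤ

infix  4 _≈_
infixl 6 _+_ _-_
infixl 7 _*_
infix  8 -_
infixr 9 _^_

_≈_ : ℤ⟦q⟧ → ℤ⟦q⟧ → Set
f ≈ g = ∀ n → f n ≡ g n

1# : ℤ⟦q⟧
1# zero    = 1ℤ
1# (suc _) = 0ℤ

q : ℤ⟦q⟧
q zero          = 0ℤ
q (suc zero)    = 1ℤ
q (suc (suc _)) = 0ℤ

_+_ : ℤ⟦q⟧ → ℤ⟦q⟧ → ℤ⟦q⟧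
(f + g) n = f n ℤ.+ g n

-_ : ℤ⟦q⟧ → ℤ⟦q⟧
(- f) n = ℤ.- f n

_-_ : ℤ⟦q⟧ → ℤ⟦q⟧ → ℤ⟦q⟧
f - g = f + - g

_*_ : ℤ⟦q⟧ → ℤ⟦q⟧ → ℤ⟦q⟧
(f * g) n = ℤ∑.sum {suc n} (λ i → f (toℕ i) ℤ.* g (n ∸ toℕ i))

_^_ : ℤ⟦q⟧ → ℕ → ℤ⟦q⟧
f ^ zero  = 1#
f ^ suc n = f * f ^ n

-- (a;q)_n
⟨_⁏q⟩_ : ℤ⟦q⟧ → ℕ → ℤ⟦q⟧
⟨ a ⁏q⟩ zero  = 1#
⟨ a ⁏q⟩ suc n = (⟨ a ⁏q⟩ n) * (1# - a * q ^ n)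

-- (a;q)_∞.  Since 1 - a q^j ≡ 1 mod q^j, the coefficient of q^n is settled by
-- the factors with j ≤ n; see qPochhammer-limit.
⟨_⁏q⟩∞ : ℤ⟦q⟧ → ℤ⟦q⟧
⟨ a ⁏q⟩∞ n = (⟨ a ⁏q⟩ suc n) n

private
  sum-zero : ∀ {n} (f : Fin n → ℤ) → (∀ i → f i ≡ 0ℤ) → ℤ∑.sum f ≡ 0ℤ
  sum-zero {n} f f≡0 = trans (ℤ∑.sum-cong-≗ f≡0) (ℤ∑.sum-replicate-zero n)

  Vanishes : ℕ → ℤ⟦q⟧ → Set
  Vanishes m f = ∀ i → i < m → f i ≡ 0ℤ

  *-vanishes : ∀ {m} f g → Vanishes m g → Vanishes m (f * g)
  *-vanishes f g g≡0 i i<m = sum-zero {suc i} _ λ j →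
    trans (cong (f (toℕ j) ℤ.*_) (g≡0 _ (ℕₚ.≤-<-trans (ℕₚ.m∸n≤m i (toℕ j)) i<m)))
          (ℤₚ.*-zeroʳ (f (toℕ j)))

  q*-vanishes : ∀ {m} f → Vanishes m f → Vanishes (suc m) (q * f)
  q*-vanishes f f≡0 i i<1+m = sum-zero {suc i} _ (term i i<1+m)
    where
    term : ∀ i → i < suc _ → ∀ (j : Fin (suc i)) → q (toℕ j) ℤ.* f (i ∸ toℕ j) ≡ 0ℤ
    term i       _         zero          = ℤₚ.*-zeroˡ (f i)
    term (suc i) (s≤s i<m) (suc zero)    = trans (ℤₚ.*-identityˡ (f i)) (f≡0 i i<m)
    term (suc i) _         (suc (suc j)) = ℤₚ.*-zeroˡ (f (i ∸ suc (toℕ j)))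

  q^-vanishes : ∀ m → Vanishes m (q ^ m)
  q^-vanishes zero    i ()
  q^-vanishes (suc m) = q*-vanishes (q ^ m) (q^-vanishes m)

  *-identityʳ-below : ∀ {m} f g → (∀ i → i < m → g i ≡ 1# i) → ∀ n → n < m → (f * g) n ≡ f n
  *-identityʳ-below f g g≡1 n n<m = trans
    (ℤ∑.sum-cong-≗ {suc n} λ j →
      cong (f (toℕ j) ℤ.*_) (g≡1 _ (ℕₚ.≤-<-trans (ℕₚ.m∸n≤m n (toℕ j)) n<m)))
    (shift n f)
    where
    shift : ∀ n f → (f * 1#) n ≡ f n
    shift zero    f = trans (ℤₚ.+-identityʳ _) (ℤₚ.*-identityʳ (f 0))
    shift (suc n) f = trans
      (cong (ℤ._+ (f ∘ suc * 1#) n) (ℤₚ.*-zeroʳ (f 0)))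
      (trans (ℤₚ.+-identityˡ _) (shift n (f ∘ suc)))

  step : ∀ a N n → n < N → (⟨ a ⁏q⟩ suc N) n ≡ (⟨ a ⁏q⟩ N) n
  step a N = *-identityʳ-below (⟨ a ⁏q⟩ N) (1# - a * q ^ N) λ i i<N → trans
    (cong (λ z → 1# i ℤ.+ ℤ.- z) (*-vanishes a (q ^ N) (q^-vanishes N) i i<N))
    (ℤₚ.+-identityʳ (1# i))

qPochhammer-limit : ∀ a n N → n < N → (⟨ a ⁏q⟩ N) n ≡ ⟨ a ⁏q⟩∞ n
qPochhammer-limit a n (suc N) (s≤s n≤N) with n ≟ N
... | yes refl = refl
... | no  n≢N  = trans (step a N n n<N) (qPochhammer-limit a n N n<N)
  where
  n<N : n < N
  n<N = ℕₚ.≤∧≢⇒< n≤N n≢N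

∑sptd : ℕ → ℤ⟦q⟧
∑sptd k zero      = 0ℤ
∑sptd k n@(suc _) = ℤ.+ sptd k n

P : (k : ℕ) → .{{NonZero k}} → ℤ⟦q⟧
P (suc zero)      = 1#
P (suc k@(suc _)) = (q ^ k - 1#) * P k + q ^ k

{-# OPTIONS --safe #-}
module Submission where

-- Bound the parts by N.  Sorting the partitions in Sptk_d by whether N + 1 occurs, and if so whether
-- it is the smallest part, gives for the generating function F_k(N) of those with parts ≤ N
--   F_k(N+1) = (1 + q^(N+1)) F_k(N) + q^(k(N+1)).
-- Induction on N then yields F_1(N) = (-q;q)_N - 1 and
--   F_{k+1}(N) + F_k(N) + q^(k(N+1)) = q^k (F_k(N) + (-q;q)_N).
-- In degrees ≤ N the term q^(k(N+1)) vanishes and F_k(N) counts all of Sptk_d, while the claimed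
-- closed form satisfies the same recurrence in k.

open import Defs
open import Algebra.Bundles using (CommutativeRing)
import Algebra.Construct.Pointwise as Pointwise
open import Algebra.Structures using (IsCommutativeRing)
open import Data.Fin.Base using (toℕ)
open import Data.Integer.Base as ℤ using (0ℤ; 1ℤ) renaming (_+_ to _+ᶻ_; _*_ to _*ᶻ_)
import Data.Integer.Properties as ℤₚ
open import Data.Integer.Tactic.RingSolver using (solve-∀)
open import Data.List.Base using (List; []; _∷_; _++_; map; filter; length; replicate)
open import Data.List.Extrema.Nat using (argmin-sel; min≤⊤; min≤xs)
open import Data.List.Membership.Propositional using (_∈_; _∉_)
open import Data.List.Membership.Propositional.Properties
  using (∈-++⁺ˡ; ∈-++⁺ʳ; ∈-++⁻; ∈-map⁺; ∈-map⁻; ∈-filter⁺; ∈-filter⁻)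
open import Data.List.Membership.Propositional.Properties.WithK using (unique∧set⇒bag)
open import Data.List.Properties
  using (filter-all; filter-none; filter-accept; filter-reject; length-replicate; ∷-injectiveʳ)
open import Data.List.Relation.Binary.BagAndSetEquality using (∼bag⇒↭)
open import Data.List.Relation.Binary.Disjoint.Propositional using (Disjoint)
open import Data.List.Relation.Binary.Permutation.Propositional.Properties using (↭-length)
open import Data.List.Relation.Unary.All as All using (All; []; _∷_)
import Data.List.Relation.Unary.All.Properties as Allₚ
open import Data.List.Relation.Unary.AllPairs as AllPairs using ([]; _∷_)
open import Data.List.Relation.Unary.Any using (here; there)
open import Data.List.Relation.Unary.Linked using (Linked; []; [-]; _∷_)
open import Data.List.Relation.Unary.Linked.Properties using (Linked⇒AllPairs)
open import Data.List.Relation.Unary.Unique.Propositional using (Unique)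
import Data.List.Relation.Unary.Unique.Propositional.Properties as Uniqueₚ
open import Data.Nat.Base as ℕ using (ℕ; zero; suc; NonZero; pred; _∸_; _<_; _≤_; _≥_; s≤s; z≤n)
import Data.Nat.Properties as ℕₚ
open import Data.Nat.Properties using (_≟_; _<?_; _≤?_)
open import Data.Nat.ListAction using (sum)
open import Data.Product.Base using (_×_; _,_; proj₂)
open import Data.Sum.Base using (inj₁; inj₂)
open import Function.Base using (_∘_; id)
open import Function.Bundles using (mk⇔; Equivalence)
open import Level using (0ℓ)
open import Relation.Binary.PropositionalEquality
  using (_≡_; _≢_; refl; sym; trans; cong; cong₂; subst; module ≡-Reasoning)
open import Relation.Nullary using (yes; no; contradiction)

import Algebra.Properties.CommutativeMonoid.Sum ℤₚ.+-0-commutativeMonoid as ℤ∑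

-- The ring of formal power series

0# : ℤ⟦q⟧
0# _ = 0ℤ

*-cong : ∀ {f f′ g g′} → f ≈ f′ → g ≈ g′ → f * g ≈ f′ * g′
*-cong f≈ g≈ n = ℤ∑.sum-cong-≗ {suc n} λ i → cong₂ _*ᶻ_ (f≈ (toℕ i)) (g≈ (n ∸ toℕ i))

-- A coefficient of a product reads its factors only up to the same degree. This lets identities
-- that are known only in low degrees be multiplied by a series.
*-congˡ-below : ∀ f {m g g′} → (∀ n → n < m → g n ≡ g′ n) → ∀ n → n < m → (f * g) n ≡ (f * g′) n
*-congˡ-below f g≡ n n<m = ℤ∑.sum-cong-≗ {suc n} λ i →
  cong (f (toℕ i) *ᶻ_) (g≡ _ (ℕₚ.≤-<-trans (ℕₚ.m∸n≤m n (toℕ i)) n<m))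

*-zeroˡ : ∀ f → 0# * f ≈ 0#
*-zeroˡ f zero    = refl
*-zeroˡ f (suc n) = trans (ℤₚ.+-identityˡ _) (*-zeroˡ f n)

*-identityˡ : ∀ f → 1# * f ≈ f
*-identityˡ f zero    = trans (ℤₚ.+-identityʳ _) (ℤₚ.*-identityˡ (f 0))
*-identityˡ f (suc n) = trans (cong₂ _+ᶻ_ (ℤₚ.*-identityˡ (f (suc n))) (*-zeroˡ f n)) (ℤₚ.+-identityʳ _)

-- The product unfolds at the end where `f` has index 0; splitting off the opposite end is what
-- makes commutativity an induction on the degree.
*-sucʳ : ∀ f g n → (f * g) (suc n) ≡ f (suc n) *ᶻ g 0 +ᶻ (f * (g ∘ suc)) n
*-sucʳ f g zero    = lemma (f 0) (f 1) (g 0) (g 1)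
  where
  lemma : ∀ a b c d → a *ᶻ d +ᶻ (b *ᶻ c +ᶻ 0ℤ) ≡ b *ᶻ c +ᶻ (a *ᶻ d +ᶻ 0ℤ)
  lemma = solve-∀
*-sucʳ f g (suc n) = trans
  (cong (f 0 *ᶻ g (suc (suc n)) +ᶻ_) (*-sucʳ (f ∘ suc) g n))
  (lemma (f 0 *ᶻ g (suc (suc n))) (f (suc (suc n)) *ᶻ g 0) ((f ∘ suc * (g ∘ suc)) n))
  where
  lemma : ∀ a b c → a +ᶻ (b +ᶻ c) ≡ b +ᶻ (a +ᶻ c)
  lemma = solve-∀

*-comm : ∀ f g → f * g ≈ g * f
*-comm f g zero    = cong (_+ᶻ 0ℤ) (ℤₚ.*-comm (f 0) (g 0))
*-comm f g (suc n) = trans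
  (cong₂ _+ᶻ_ (ℤₚ.*-comm (f 0) (g (suc n))) (*-comm (f ∘ suc) g n))
  (sym (*-sucʳ g f n))

*-distribʳ-+ : ∀ h f g → (f + g) * h ≈ f * h + g * h
*-distribʳ-+ h f g zero    = lemma (f 0) (g 0) (h 0)
  where
  lemma : ∀ a b c → (a +ᶻ b) *ᶻ c +ᶻ 0ℤ ≡ (a *ᶻ c +ᶻ 0ℤ) +ᶻ (b *ᶻ c +ᶻ 0ℤ)
  lemma = solve-∀
*-distribʳ-+ h f g (suc n) = trans
  (cong ((f 0 +ᶻ g 0) *ᶻ h (suc n) +ᶻ_) (*-distribʳ-+ h (f ∘ suc) (g ∘ suc) n))
  (lemma (f 0) (g 0) (h (suc n)) ((f ∘ suc * h) n) ((g ∘ suc * h) n))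
  where
  lemma : ∀ a b c x y →
    (a +ᶻ b) *ᶻ c +ᶻ (x +ᶻ y) ≡ (a *ᶻ c +ᶻ x) +ᶻ (b *ᶻ c +ᶻ y)
  lemma = solve-∀

*-scaleˡ : ∀ c f g n → ((λ i → c *ᶻ f i) * g) n ≡ c *ᶻ (f * g) n
*-scaleˡ c f g zero    = lemma c (f 0) (g 0)
  where
  lemma : ∀ c a b → (c *ᶻ a) *ᶻ b +ᶻ 0ℤ ≡ c *ᶻ (a *ᶻ b +ᶻ 0ℤ)
  lemma = solve-∀
*-scaleˡ c f g (suc n) = trans
  (cong (c *ᶻ f 0 *ᶻ g (suc n) +ᶻ_) (*-scaleˡ c (f ∘ suc) g n))
  (lemma c (f 0) (g (suc n)) ((f ∘ suc * g) n))
  where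
  lemma : ∀ c a b x → (c *ᶻ a) *ᶻ b +ᶻ c *ᶻ x ≡ c *ᶻ (a *ᶻ b +ᶻ x)
  lemma = solve-∀

*-assoc : ∀ f g h → (f * g) * h ≈ f * (g * h)
*-assoc f g h zero    = lemma (f 0) (g 0) (h 0)
  where
  lemma : ∀ a b c → (a *ᶻ b +ᶻ 0ℤ) *ᶻ c +ᶻ 0ℤ ≡ a *ᶻ (b *ᶻ c +ᶻ 0ℤ) +ᶻ 0ℤ
  lemma = solve-∀
*-assoc f g h (suc n) = begin
  -- Unfolding at successor degrees turns `(f * g) ∘ suc` into a scalar multiple of `g ∘ suc` plus
  -- `f ∘ suc * g`; `*-scaleˡ` takes care of the scalar.
  (f * g) 0 *ᶻ h (suc n) +ᶻ (((λ i → f 0 *ᶻ g (suc i)) + f ∘ suc * g) * h) n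
    ≡⟨ cong ((f * g) 0 *ᶻ h (suc n) +ᶻ_)
         (*-distribʳ-+ h (λ i → f 0 *ᶻ g (suc i)) (f ∘ suc * g) n) ⟩
  (f * g) 0 *ᶻ h (suc n) +ᶻ (((λ i → f 0 *ᶻ g (suc i)) * h) n +ᶻ (f ∘ suc * g * h) n)
    ≡⟨ cong ((f * g) 0 *ᶻ h (suc n) +ᶻ_)
         (cong₂ _+ᶻ_ (*-scaleˡ (f 0) (g ∘ suc) h n) (*-assoc (f ∘ suc) g h n)) ⟩
  (f * g) 0 *ᶻ h (suc n) +ᶻ (f 0 *ᶻ (g ∘ suc * h) n +ᶻ (f ∘ suc * (g * h)) n)
    ≡⟨ lemma (f 0) (g 0) (h (suc n)) ((g ∘ suc * h) n) ((f ∘ suc * (g * h)) n) ⟩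
  f 0 *ᶻ (g * h) (suc n) +ᶻ (f ∘ suc * (g * h)) n ∎
  where
  open ≡-Reasoning
  lemma : ∀ a b c x y →
    (a *ᶻ b +ᶻ 0ℤ) *ᶻ c +ᶻ (a *ᶻ x +ᶻ y) ≡ a *ᶻ (b *ᶻ c +ᶻ x) +ᶻ y
  lemma = solve-∀

isCommutativeRing : IsCommutativeRing _≈_ _+_ _*_ -_ 0# 1#
isCommutativeRing = record
  { isRing = record
    { +-isAbelianGroup = Pointwise.isAbelianGroup ℕ ℤₚ.+-0-isAbelianGroup
    ; *-cong           = *-cong
    ; *-assoc          = *-assoc
    ; *-identity       = *-identityˡ , λ f n → trans (*-comm f 1# n) (*-identityˡ f n)
    ; distrib          = (λ f g h n → trans (*-comm f (g + h) n)
                           (trans (*-distribʳ-+ f g h n)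
                             (cong₂ _+ᶻ_ (*-comm g f n) (*-comm h f n))))
                       , *-distribʳ-+
    }
  ; *-comm = *-comm
  }

commutativeRing : CommutativeRing 0ℓ 0ℓ
commutativeRing = record { isCommutativeRing = isCommutativeRing }

private module R = CommutativeRing commutativeRing

import Algebra.Solver.Ring.NaturalCoefficients.Default R.commutativeSemiring as Solver
import Relation.Binary.Reasoning.Setoid R.setoid as ≈-Reasoning
open import Algebra.Properties.Ring R.ring using (-‿distribˡ-*; -1*x≈-x)
open Solver using (_:+_; _:*_; _:=_; con)

-- Generating functions of lists of partitions

q*-suc : ∀ f n → (q * f) (suc n) ≡ f n
q*-suc f n = trans (ℤₚ.+-identityˡ _) (trans (*-cong {g = f} q∘suc≈1 (λ _ → refl) n) (*-identityˡ f n))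
  where
  q∘suc≈1 : q ∘ suc ≈ 1#
  q∘suc≈1 zero    = refl
  q∘suc≈1 (suc _) = refl

q^-coeff-≡ : ∀ m → (q ^ m) m ≡ 1ℤ
q^-coeff-≡ zero    = refl
q^-coeff-≡ (suc m) = trans (q*-suc (q ^ m) m) (q^-coeff-≡ m)

q^-coeff-≢ : ∀ m n → m ≢ n → (q ^ m) n ≡ 0ℤ
q^-coeff-≢ zero    zero    m≢n = contradiction refl m≢n
q^-coeff-≢ zero    (suc n) m≢n = refl
q^-coeff-≢ (suc m) zero    m≢n = refl
q^-coeff-≢ (suc m) (suc n) m≢n = trans (q*-suc (q ^ m) n) (q^-coeff-≢ m n (m≢n ∘ cong suc))

q^-homo-* : ∀ m n → q ^ (m ℕ.+ n) ≈ q ^ m * q ^ n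
q^-homo-* zero    n = R.sym (*-identityˡ (q ^ n))
q^-homo-* (suc m) n = begin
  q * q ^ (m ℕ.+ n)     ≈⟨ R.*-congˡ {q} (q^-homo-* m n) ⟩
  q * (q ^ m * q ^ n)   ≈⟨ *-assoc q (q ^ m) (q ^ n) ⟨
  q * q ^ m * q ^ n     ∎
  where open ≈-Reasoning

genFun : List (List ℕ) → ℤ⟦q⟧
genFun []       = 0#
genFun (π ∷ xs) = q ^ sum π + genFun xs

genFun-++ : ∀ xs ys → genFun (xs ++ ys) ≈ genFun xs + genFun ys
genFun-++ []       ys n = sym (ℤₚ.+-identityˡ _)
genFun-++ (π ∷ xs) ys n = trans
  (cong ((q ^ sum π) n +ᶻ_) (genFun-++ xs ys n))
  (sym (ℤₚ.+-assoc ((q ^ sum π) n) (genFun xs n) (genFun ys n)))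

genFun-map-∷ : ∀ x xs → genFun (map (x ∷_) xs) ≈ q ^ x * genFun xs
genFun-map-∷ x []       = R.sym (R.zeroʳ (q ^ x))
genFun-map-∷ x (π ∷ xs) = begin
  q ^ (x ℕ.+ sum π) + genFun (map (x ∷_) xs)   ≈⟨ R.+-cong (q^-homo-* x (sum π)) (genFun-map-∷ x xs) ⟩
  q ^ x * q ^ sum π + q ^ x * genFun xs        ≈⟨ R.distribˡ (q ^ x) (q ^ sum π) (genFun xs) ⟨
  q ^ x * (q ^ sum π + genFun xs)              ∎
  where open ≈-Reasoning

genFun-coeff : ∀ xs n → genFun xs n ≡ ℤ.+ length (filter (λ π → sum π ≟ n) xs)
genFun-coeff []       n = refl
genFun-coeff (π ∷ xs) n with sum π ≟ n
... | yes Σ≡n = begin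
  (q ^ sum π) n +ᶻ genFun xs n
    ≡⟨ cong₂ _+ᶻ_ (trans (cong (q ^ sum π) (sym Σ≡n)) (q^-coeff-≡ (sum π))) (genFun-coeff xs n) ⟩
  ℤ.+ suc (length (filter (λ π → sum π ≟ n) xs))
    ≡⟨ cong (λ ys → ℤ.+ length ys) (filter-accept (λ π → sum π ≟ n) {π} {xs} Σ≡n) ⟨
  ℤ.+ length (filter (λ π → sum π ≟ n) (π ∷ xs)) ∎
  where open ≡-Reasoning
... | no  Σ≢n = begin
  (q ^ sum π) n +ᶻ genFun xs n
    ≡⟨ cong₂ _+ᶻ_ (q^-coeff-≢ (sum π) n Σ≢n) (genFun-coeff xs n) ⟩
  ℤ.+ length (filter (λ π → sum π ≟ n) xs)
    ≡⟨ cong (λ ys → ℤ.+ length ys) (filter-reject (λ π → sum π ≟ n) {π} {xs} Σ≢n) ⟨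
  ℤ.+ length (filter (λ π → sum π ≟ n) (π ∷ xs)) ∎
  where open ≡-Reasoning

-- Partitions in Sptk_d with bounded parts

-- For k > 0 this lists the partitions in Sptk_d(n), for all n, whose parts are at most N.
Sptd≤ : ℕ → ℕ → List (List ℕ)
Sptd≤ k zero    = []
Sptd≤ k (suc N) =
  Sptd≤ k N ++ map (suc N ∷_) (Sptd≤ k N) ++ replicate k (suc N) ∷ []

s-∈ : ∀ x π → s (x ∷ π) ∈ x ∷ π
s-∈ x π with argmin-sel id x π
... | inj₁ s≡x = here s≡x
... | inj₂ s∈π = there s∈π

s-≤ : ∀ π → All (s π ≤_) π
s-≤ []      = []
s-≤ (x ∷ π) = min≤⊤ x π ∷ min≤xs x π

-- Smallest parts are identified below by this criterion, without evaluating the fold behind `min`.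
s-unique : ∀ {m π} → m ∈ π → All (m ≤_) π → s π ≡ m
s-unique {π = x ∷ π} m∈ m≤ =
  ℕₚ.≤-antisym (All.lookup (s-≤ (x ∷ π)) m∈) (All.lookup m≤ (s-∈ x π))

All-≡⇒replicate : ∀ {x : ℕ} {π} → All (x ≡_) π → π ≡ replicate (length π) x
All-≡⇒replicate []           = refl
All-≡⇒replicate (refl ∷ eqs) = cong (_ ∷_) (All-≡⇒replicate eqs)

head-≥ : ∀ {x π} → Linked _≥_ (x ∷ π) → All (_≤ x) π
head-≥ dec = AllPairs.head (Linked⇒AllPairs (λ i≥j j≥k → ℕₚ.≤-trans j≥k i≥j) dec)

replicate-isSptd : ∀ k {x} → 0 < x → IsSptd (suc k) (sum (replicate (suc k) x)) (replicate (suc k) x)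
replicate-isSptd k {x} 0<x =
  (Allₚ.replicate⁺ (suc k) 0<x , linked (suc k) , refl) , occ , uniq
  where
  π = replicate (suc k) x

  linked : ∀ m → Linked _≥_ (replicate m x)
  linked zero          = []
  linked (suc zero)    = [-]
  linked (suc (suc m)) = ℕₚ.≤-refl ∷ linked (suc m)

  s≡x : s π ≡ x
  s≡x = s-unique (here refl) (Allₚ.replicate⁺ (suc k) ℕₚ.≤-refl)

  occ : occurrences (s π) π ≡ suc k
  occ = trans (cong (λ m → occurrences m π) s≡x)
    (trans (cong length (filter-all (x ≟_) (Allₚ.replicate⁺ (suc k) refl)))
           (length-replicate (suc k)))

  uniq : Unique (filter (s π <?_) π)
  uniq = subst Unique
    (sym (trans (cong (λ m → filter (m <?_) π) s≡x)
      (filter-none (x <?_) (Allₚ.replicate⁺ (suc k) (ℕₚ.<-irrefl refl))))) []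

-- Multiplicity `suc k` forces `π` to be nonempty, so the larger `x` cannot become the smallest
-- part; it only joins the parts above it, where it is new.
isSptd-∷⁺ : ∀ {k n x π} → All (_< x) π → IsSptd (suc k) n π → IsSptd (suc k) (x ℕ.+ n) (x ∷ π)
isSptd-∷⁺ {x = x} {π = y ∷ ρ} <x@(y<x ∷ _) ((pos@(0<y ∷ _) , dec , eq) , occ , uniq) =
  (ℕₚ.<-trans 0<y y<x ∷ pos , ℕₚ.<⇒≤ y<x ∷ dec , cong (x ℕ.+_) eq) ,
  trans (cong (λ m → occurrences m (x ∷ π)) s≡)
    (trans (cong length (filter-reject (s π ≟_) (ℕₚ.<⇒≢ s<x))) occ) ,
  subst Unique
    (sym (trans (cong (λ m → filter (m <?_) (x ∷ π)) s≡) (filter-accept (s π <?_) s<x)))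
    (All.map ℕₚ.>⇒≢ (Allₚ.filter⁺ (s π <?_) <x) ∷ uniq)
  where
  π = y ∷ ρ

  s<x : s π < x
  s<x = All.lookup <x (s-∈ y ρ)

  s≡ : s (x ∷ π) ≡ s π
  s≡ = s-unique (there (s-∈ y ρ)) (ℕₚ.<⇒≤ s<x ∷ s-≤ π)

-- When the head is not the smallest part, the smallest part survives in the tail with its full
-- multiplicity. The strict bound comes from distinctness.
isSptd-∷⁻ : ∀ {k n x π} → s (x ∷ π) ≢ x → IsSptd k n (x ∷ π) →
            All (_< x) π × IsSptd k (sum π) π
isSptd-∷⁻ {π = []} s≢x _ = contradiction refl s≢x
isSptd-∷⁻ {x = x} {π = y ∷ ρ} s≢x ((_ ∷ pos , x≥y ∷ dec , _) , occ , uniq) =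
  All.tabulate <x , (pos , dec , refl) ,
  trans (cong (λ m → occurrences m π) s≡)
    (trans (cong length (sym (filter-reject (m ≟_) s≢x))) occ) ,
  subst (λ m → Unique (filter (m <?_) π)) (sym s≡) (AllPairs.tail uniq′)
  where
  π = y ∷ ρ
  m = s (x ∷ π)

  m<x : m < x
  m<x = ℕₚ.≤∧≢⇒< (All.lookup (s-≤ (x ∷ π)) (here refl)) s≢x

  m∈π : m ∈ π
  m∈π with s-∈ x π
  ... | here m≡x  = contradiction m≡x s≢x
  ... | there m∈π = m∈π

  s≡ : s π ≡ m
  s≡ = s-unique m∈π (All.tail (s-≤ (x ∷ π)))

  uniq′ : Unique (x ∷ filter (m <?_) π)
  uniq′ = subst Unique (filter-accept (m <?_) m<x) uniq

  -- A second copy of `x` would be a repetition among the parts above `m`, which `uniq′` forbids.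
  <x : ∀ {z} → z ∈ π → z < x
  <x z∈π = ℕₚ.≤∧≢⇒< (All.lookup (head-≥ (x≥y ∷ dec)) z∈π)
    λ { refl → All.lookup (AllPairs.head uniq′) (∈-filter⁺ (m <?_) z∈π m<x) refl }

-- The head of a weakly decreasing list is its largest part. If it is also the smallest, all parts
-- coincide and the multiplicity is the length.
isSptd-s≡head : ∀ {k n x π} → s (x ∷ π) ≡ x → IsSptd k n (x ∷ π) → x ∷ π ≡ replicate k x
isSptd-s≡head {x = x} {π} s≡x ((_ , dec , _) , occ , _) =
  trans (All-≡⇒replicate ≡x)
    (cong (λ m → replicate m x)
      (trans (sym (cong length (filter-all (x ≟_) ≡x)))
        (trans (cong (λ m → occurrences m (x ∷ π)) (sym s≡x)) occ)))
  where
  ≡x : All (x ≡_) (x ∷ π)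
  ≡x = refl ∷ All.zipWith (λ (≤x , x≤) → ℕₚ.≤-antisym x≤ ≤x)
    ( head-≥ dec
    , subst (λ m → All (m ≤_) π) s≡x (All.tail (s-≤ (x ∷ π))) )

Sptd≤-sound : ∀ k N {π} → π ∈ Sptd≤ (suc k) N → All (_≤ N) π × IsSptd (suc k) (sum π) π
Sptd≤-sound k (suc N) π∈ with ∈-++⁻ (Sptd≤ (suc k) N) π∈
... | inj₁ π∈₁ = let ≤N , spt = Sptd≤-sound k N π∈₁ in All.map ℕₚ.m≤n⇒m≤1+n ≤N , spt
... | inj₂ π∈₂ with ∈-++⁻ (map (suc N ∷_) (Sptd≤ (suc k) N)) π∈₂
...   | inj₂ (here refl) = Allₚ.replicate⁺ (suc k) ℕₚ.≤-refl , replicate-isSptd k (s≤s z≤n)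
...   | inj₁ π∈₃ with ∈-map⁻ (suc N ∷_) π∈₃
...     | ρ , ρ∈ , refl = let ≤N , spt = Sptd≤-sound k N ρ∈ in
  ℕₚ.≤-refl ∷ All.map ℕₚ.m≤n⇒m≤1+n ≤N , isSptd-∷⁺ (All.map s≤s ≤N) spt

-- The largest part is the head. If it is at most `N`, induction applies to the whole list;
-- otherwise it is `suc N`, and comparing it with the smallest part selects one of the other two
-- blocks of `Sptd≤`.
Sptd≤-complete : ∀ k N {n π} → All (_≤ N) π → IsSptd (suc k) n π → π ∈ Sptd≤ (suc k) N
-- The dummy smallest part of `[]` occurs 0 times, never `suc k` times.
Sptd≤-complete k N       {π = []}    _ (_ , () , _)
Sptd≤-complete k zero    {π = x ∷ π} (x≤0 ∷ _) ((0<x ∷ _ , _) , _) =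
  contradiction x≤0 (ℕₚ.<⇒≱ 0<x)
Sptd≤-complete k (suc N) {π = x ∷ π} (x≤1+N ∷ _) spt@((_ , dec , _) , _) with x ≤? N
... | yes x≤N = ∈-++⁺ˡ
  (Sptd≤-complete k N (x≤N ∷ All.map (λ y≤x → ℕₚ.≤-trans y≤x x≤N) (head-≥ dec)) spt)
... | no  x≰N with ℕₚ.≤-antisym x≤1+N (ℕₚ.≰⇒> x≰N) | s (x ∷ π) ≟ x
...   | refl | yes s≡x =
  ∈-++⁺ʳ (Sptd≤ (suc k) N) (∈-++⁺ʳ (map (suc N ∷_) _) (here (isSptd-s≡head s≡x spt)))
...   | refl | no  s≢x = let <x , spt′ = isSptd-∷⁻ s≢x spt in
  ∈-++⁺ʳ (Sptd≤ (suc k) N)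
    (∈-++⁺ˡ (∈-map⁺ (suc N ∷_) (Sptd≤-complete k N (All.map ℕ.s≤s⁻¹ <x) spt′)))

∷∉Sptd≤ : ∀ k N {ρ} → suc N ∷ ρ ∉ Sptd≤ (suc k) N
∷∉Sptd≤ k N ∈N with Sptd≤-sound k N ∈N
... | 1+N≤N ∷ _ , _ = ℕₚ.1+n≰n 1+N≤N

-- This is the block of `suc k` copies with its head removed, as needed to separate it from the
-- lists obtained by prepending `suc N`. For `k` zero it is empty, so its multiplicity rules it out
-- rather than the size of its parts.
replicate∉Sptd≤ : ∀ k N → replicate k (suc N) ∉ Sptd≤ (suc k) N
replicate∉Sptd≤ (suc k) N ∈N = ∷∉Sptd≤ (suc k) N ∈N
replicate∉Sptd≤ zero    N ∈N with Sptd≤-sound 0 N ∈N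
... | _ , _ , () , _

Sptd≤-unique : ∀ k N → Unique (Sptd≤ (suc k) N)
Sptd≤-unique k zero    = []
Sptd≤-unique k (suc N) = Uniqueₚ.++⁺ ih
  (Uniqueₚ.++⁺ (Uniqueₚ.map⁺ ∷-injectiveʳ ih) ([] ∷ []) disjointʳ) disjointˡ
  where
  ih = Sptd≤-unique k N
  with-1+N = map (suc N ∷_) (Sptd≤ (suc k) N)
  only-1+N = replicate (suc k) (suc N) ∷ []

  disjointʳ : Disjoint with-1+N only-1+N
  disjointʳ (π∈ , here refl) with ∈-map⁻ (suc N ∷_) π∈
  ... | _ , ρ∈ , refl = replicate∉Sptd≤ k N ρ∈

  disjointˡ : Disjoint (Sptd≤ (suc k) N) (with-1+N ++ only-1+N)
  disjointˡ (π∈ , π∈′) with ∈-++⁻ with-1+N π∈′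
  ... | inj₂ (here refl) = ∷∉Sptd≤ k N π∈
  ... | inj₁ π∈ˡ with ∈-map⁻ (suc N ∷_) π∈ˡ
  ...   | _ , _ , refl = ∷∉Sptd≤ k N π∈

parts≤sum : ∀ π → All (_≤ sum π) π
parts≤sum []      = []
parts≤sum (x ∷ π) =
  ℕₚ.m≤m+n x (sum π) ∷
  All.map (λ y≤ → ℕₚ.≤-trans y≤ (ℕₚ.m≤n+m (sum π) x)) (parts≤sum π)

-- Both lists are free of duplicates and have the same members, hence are permutations of each
-- other: no part of a partition of `n` exceeds `n`, so the bound `N` excludes nothing.
sptd-Sptd≤ : ∀ k {n N} → n ≤ N →
             sptd (suc k) n ≡ length (filter (λ π → sum π ≟ n) (Sptd≤ (suc k) N))
sptd-Sptd≤ k {n} {N} n≤N = ↭-length (∼bag⇒↭ (unique∧set⇒bag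
  (Sptd-unique (suc k) n)
  (Uniqueₚ.filter⁺ (λ π → sum π ≟ n) (Sptd≤-unique k N))
  (mk⇔ to from)))
  where
  to : ∀ {π} → π ∈ Sptd (suc k) n → π ∈ filter (λ π → sum π ≟ n) (Sptd≤ (suc k) N)
  to {π} π∈ with Equivalence.to (∈-Sptd⇔ (suc k) n) π∈
  ... | spt@((_ , _ , refl) , _) = ∈-filter⁺ (λ π → sum π ≟ n)
    (Sptd≤-complete k N (All.map (λ x≤ → ℕₚ.≤-trans x≤ n≤N) (parts≤sum π)) spt) refl

  from : ∀ {π} → π ∈ filter (λ π → sum π ≟ n) (Sptd≤ (suc k) N) → π ∈ Sptd (suc k) n
  from π∈ with ∈-filter⁻ (λ π → sum π ≟ n) {xs = Sptd≤ (suc k) N} π∈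
  ... | π∈≤ , refl = Equivalence.from (∈-Sptd⇔ (suc k) n) (proj₂ (Sptd≤-sound k N π∈≤))

-- Recurrences and closed form

F : ℕ → ℕ → ℤ⟦q⟧
F k N = genFun (Sptd≤ k N)

sum-replicate : ∀ k x → sum (replicate k x) ≡ k ℕ.* x
sum-replicate zero    x = refl
sum-replicate (suc k) x = cong (x ℕ.+_) (sum-replicate k x)

F-suc : ∀ k N → F k (suc N) ≈ (1# + q ^ suc N) * F k N + q ^ (k ℕ.* suc N)
F-suc k N = begin
  F k (suc N)
    ≈⟨ genFun-++ (Sptd≤ k N) _ ⟩
  F k N + genFun (map (suc N ∷_) (Sptd≤ k N) ++ replicate k (suc N) ∷ [])
    ≈⟨ R.+-congˡ {F k N} (genFun-++ (map (suc N ∷_) (Sptd≤ k N)) _) ⟩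
  F k N + (genFun (map (suc N ∷_) (Sptd≤ k N)) + (q ^ sum (replicate k (suc N)) + 0#))
    ≈⟨ R.+-congˡ {F k N} (R.+-cong (genFun-map-∷ (suc N) (Sptd≤ k N))
         (λ n → cong (λ m → (q ^ m + 0#) n) (sum-replicate k (suc N)))) ⟩
  F k N + (q ^ suc N * F k N + (q ^ (k ℕ.* suc N) + 0#))
    ≈⟨ Solver.solve 3 (λ f u v → f :+ (u :* f :+ (v :+ con 0)) := (con 1 :+ u) :* f :+ v)
         (λ _ → refl) (F k N) (q ^ suc N) (q ^ (k ℕ.* suc N)) ⟩
  (1# + q ^ suc N) * F k N + q ^ (k ℕ.* suc N) ∎
  where open ≈-Reasoning

⟨-q⁏q⟩-suc : ∀ N → ⟨ - q ⁏q⟩ suc N ≈ (1# + q ^ suc N) * ⟨ - q ⁏q⟩ N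
⟨-q⁏q⟩-suc N = begin
  A * (1# - (- q) * q ^ N)   ≈⟨ R.*-congˡ {A} (R.+-congˡ {1#} neg) ⟩
  A * (1# + q ^ suc N)       ≈⟨ *-comm A (1# + q ^ suc N) ⟩
  (1# + q ^ suc N) * A       ∎
  where
  open ≈-Reasoning
  A = ⟨ - q ⁏q⟩ N
  neg : - ((- q) * q ^ N) ≈ q * q ^ N
  neg n = trans (cong ℤ.-_ (sym (-‿distribˡ-* q (q ^ N) n))) (ℤₚ.neg-involutive _)

-- For `k = 1` all parts are distinct, and (-q;q)_N generates the partitions into distinct parts at
-- most `N`; `1#` supplies the empty one.
F₁-closed : ∀ N → F 1 N + 1# ≈ ⟨ - q ⁏q⟩ N
F₁-closed zero    n = ℤₚ.+-identityˡ (1# n)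
F₁-closed (suc N) = begin
  F 1 (suc N) + 1#
    ≈⟨ R.+-congʳ {1#} (F-suc 1 N) ⟩
  (1# + u) * F 1 N + q ^ (1 ℕ.* suc N) + 1#
    ≈⟨ R.+-congʳ {1#} (R.+-congˡ {(1# + u) * F 1 N}
         (λ n → cong (λ m → (q ^ m) n) (ℕₚ.*-identityˡ (suc N)))) ⟩
  (1# + u) * F 1 N + u + 1#
    ≈⟨ Solver.solve 2 (λ f u →
         (con 1 :+ u) :* f :+ u :+ con 1 := (con 1 :+ u) :* (f :+ con 1))
         (λ _ → refl) (F 1 N) u ⟩
  (1# + u) * (F 1 N + 1#)
    ≈⟨ R.*-congˡ {1# + u} (F₁-closed N) ⟩
  (1# + u) * ⟨ - q ⁏q⟩ N
    ≈⟨ ⟨-q⁏q⟩-suc N ⟨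
  ⟨ - q ⁏q⟩ suc N ∎
  where
  open ≈-Reasoning
  u = q ^ suc N

-- The power `q ^ (k ℕ.* suc N)` is a boundary correction that makes the identity exact for finite
-- `N`. In the induction the two block terms add up to `(1# + u) * v`, completing the induction
-- hypothesis, and the new correction `w * v` is `w` times the block term of `F k (suc N)`.
F-recurrence : ∀ k N → F (suc k) N + F k N + q ^ (k ℕ.* suc N) ≈ q ^ k * (F k N + ⟨ - q ⁏q⟩ N)
F-recurrence k zero    = begin
  0# + 0# + q ^ (k ℕ.* 1)
    ≈⟨ R.+-congˡ {0# + 0#} (λ n → cong (λ m → (q ^ m) n) (ℕₚ.*-identityʳ k)) ⟩
  0# + 0# + q ^ k
    ≈⟨ Solver.solve 1 (λ w → con 0 :+ con 0 :+ w := w :* (con 0 :+ con 1))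
         (λ _ → refl) (q ^ k) ⟩
  q ^ k * (0# + 1#) ∎
  where open ≈-Reasoning
F-recurrence k (suc N) = begin
  F (suc k) (suc N) + F k (suc N) + q ^ (k ℕ.* suc (suc N))
    ≈⟨ R.+-cong (R.+-cong (F-suc (suc k) N) (F-suc k N))
         (λ n → cong (λ m → (q ^ m) n) (ℕₚ.*-suc k (suc N))) ⟩
  ((1# + u) * F′ + q ^ (suc N ℕ.+ k ℕ.* suc N)) + ((1# + u) * F₀ + v) + q ^ (k ℕ.+ k ℕ.* suc N)
    ≈⟨ R.+-cong
         (R.+-congʳ {(1# + u) * F₀ + v}
           (R.+-congˡ {(1# + u) * F′} (q^-homo-* (suc N) (k ℕ.* suc N))))
         (q^-homo-* k (k ℕ.* suc N)) ⟩
  ((1# + u) * F′ + u * v) + ((1# + u) * F₀ + v) + w * v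
    ≈⟨ Solver.solve 5 (λ f′ f u v w →
         ((con 1 :+ u) :* f′ :+ u :* v) :+ ((con 1 :+ u) :* f :+ v) :+ w :* v :=
         (con 1 :+ u) :* (f′ :+ f :+ v) :+ w :* v) (λ _ → refl) F′ F₀ u v w ⟩
  (1# + u) * (F′ + F₀ + v) + w * v
    ≈⟨ R.+-congʳ {w * v} (R.*-congˡ {1# + u} (F-recurrence k N)) ⟩
  (1# + u) * (w * (F₀ + A)) + w * v
    ≈⟨ Solver.solve 5 (λ f a u v w →
         (con 1 :+ u) :* (w :* (f :+ a)) :+ w :* v :=
         w :* (((con 1 :+ u) :* f :+ v) :+ (con 1 :+ u) :* a)) (λ _ → refl) F₀ A u v w ⟩
  w * (((1# + u) * F₀ + v) + (1# + u) * A)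
    ≈⟨ R.*-congˡ {w} (R.+-cong (F-suc k N) (⟨-q⁏q⟩-suc N)) ⟨
  w * (F k (suc N) + ⟨ - q ⁏q⟩ suc N) ∎
  where
  open ≈-Reasoning
  F′ = F (suc k) N
  F₀ = F k N
  A = ⟨ - q ⁏q⟩ N
  u = q ^ suc N
  v = q ^ (k ℕ.* suc N)
  w = q ^ k

-- Here `j` stands for k - 1. The series `A` is left open so that both (-q;q)_N, for which the
-- recurrences are proved, and (-q;q)_∞ can be inserted.
closedForm : ℕ → ℤ⟦q⟧ → ℤ⟦q⟧
closedForm j A = P (suc j) * A + (- 1#) ^ suc j * (⟨ q ⁏q⟩ j)

closedForm-zero : ∀ A → closedForm 0 A ≈ A - 1#
closedForm-zero A = R.+-cong (*-identityˡ A) (begin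
  - 1# * 1# * 1#   ≈⟨ R.*-identityʳ (- 1# * 1#) ⟩
  - 1# * 1#        ≈⟨ R.*-identityʳ (- 1#) ⟩
  - 1#             ∎)
  where open ≈-Reasoning

-- This is `F-recurrence` without its boundary term. Passing from k to k + 1 multiplies both `P k`
-- and the signed product (-1)^k (q;q)_{k-1} by q^k - 1, and `P` gains a further q^k.
closedForm-suc : ∀ j A →
  closedForm (suc j) A ≈ q ^ suc j * (closedForm j A + A) - closedForm j A
closedForm-suc j A = begin
  ((w - 1#) * p + w) * A + (- 1# * e) * (d * (1# - w))
    -- The solver has natural coefficients only, so `- 1#` and `1# - w` enter as atoms; they are
    -- brought together for `flip`.
    ≈⟨ Solver.solve 7 (λ w m p e d y a →
         ((w :+ m) :* p :+ w) :* a :+ (m :* e) :* (d :* y) :=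
         ((w :+ m) :* p :+ w) :* a :+ (m :* y) :* (e :* d))
         (λ _ → refl) w (- 1#) p e d (1# - w) A ⟩
  ((w - 1#) * p + w) * A + (- 1# * (1# - w)) * (e * d)
    ≈⟨ R.+-congˡ {((w - 1#) * p + w) * A} (R.*-congʳ {e * d} flip) ⟩
  ((w - 1#) * p + w) * A + (w - 1#) * (e * d)
    ≈⟨ Solver.solve 6 (λ w m p e d a →
         ((w :+ m) :* p :+ w) :* a :+ (w :+ m) :* (e :* d) :=
         w :* (p :* a :+ e :* d :+ a) :+ m :* (p :* a :+ e :* d)) (λ _ → refl) w (- 1#) p e d A ⟩
  w * (closedForm j A + A) + - 1# * closedForm j A
    ≈⟨ R.+-congˡ {w * (closedForm j A + A)} (-1*x≈-x (closedForm j A)) ⟩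
  w * (closedForm j A + A) - closedForm j A ∎
  where
  open ≈-Reasoning
  w = q ^ suc j
  p = P (suc j)
  e = (- 1#) ^ suc j
  d = ⟨ q ⁏q⟩ j

  flip : - 1# * (1# - w) ≈ w - 1#
  flip n = trans (-1*x≈-x (1# - w) n) (lemma (1# n) (w n))
    where
    lemma : ∀ a b → ℤ.- (a +ᶻ (ℤ.- b)) ≡ b +ᶻ (ℤ.- a)
    lemma = solve-∀

-- Below degree `N` the boundary term of `F-recurrence` vanishes, so both sides obey the same
-- recurrence in `j`.
F-closed : ∀ j N n → n < N → F (suc j) N n ≡ closedForm j (⟨ - q ⁏q⟩ N) n
F-closed zero    N n _   = begin
  F 1 N n                          ≡⟨ lemma (F 1 N n) (1# n) ⟩
  (F 1 N + 1# - 1#) n              ≡⟨ cong (_+ᶻ (- 1#) n) (F₁-closed N n) ⟩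
  (⟨ - q ⁏q⟩ N - 1#) n             ≡⟨ closedForm-zero (⟨ - q ⁏q⟩ N) n ⟨
  closedForm 0 (⟨ - q ⁏q⟩ N) n     ∎
  where
  open ≡-Reasoning
  lemma : ∀ a b → a ≡ a +ᶻ b +ᶻ (ℤ.- b)
  lemma = solve-∀
F-closed (suc j) N n n<N = begin
  F′ n
    ≡⟨ lemma (F′ n) (F₀ n) ⟩
  F′ n +ᶻ F₀ n +ᶻ 0ℤ +ᶻ (- F₀) n
    ≡⟨ cong (λ z → F′ n +ᶻ F₀ n +ᶻ z +ᶻ (- F₀) n) (q^-coeff-≢ _ n (ℕₚ.>⇒≢ n<k*[1+N])) ⟨
  (F′ + F₀ + q ^ (suc j ℕ.* suc N) - F₀) n
    ≡⟨ cong (_+ᶻ (- F₀) n) (F-recurrence (suc j) N n) ⟩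
  (q ^ suc j * (F₀ + A) - F₀) n
    -- Multiplication by a power of `q` calls for the induction hypothesis in all degrees up to `n`,
    -- not just at `n`.
    ≡⟨ cong₂ (λ x y → x +ᶻ (ℤ.- y))
         (*-congˡ-below (q ^ suc j) {g = F₀ + A} {g′ = closedForm j A + A}
           (λ i i<N → cong (_+ᶻ A i) (F-closed j N i i<N)) n n<N)
         (F-closed j N n n<N) ⟩
  (q ^ suc j * (closedForm j A + A) - closedForm j A) n
    ≡⟨ closedForm-suc j A n ⟨
  closedForm (suc j) A n ∎
  where
  open ≡-Reasoning
  A = ⟨ - q ⁏q⟩ N
  F′ = F (suc (suc j)) N
  F₀ = F (suc j) N
  lemma : ∀ a b → a ≡ a +ᶻ b +ᶻ 0ℤ +ᶻ (ℤ.- b)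
  lemma = solve-∀
  n<k*[1+N] : n < suc j ℕ.* suc N
  n<k*[1+N] = ℕₚ.<-≤-trans n<N (ℕₚ.≤-trans (ℕₚ.n≤1+n N) (ℕₚ.m≤m+n (suc N) (j ℕ.* suc N)))

-- `∑sptd` sets its constant term to 0 by definition. This agrees with the count, since the only
-- candidate, the empty list, has multiplicity 0.
∑sptd-coeff : ∀ j n → ∑sptd (suc j) n ≡ ℤ.+ sptd (suc j) n
∑sptd-coeff j zero    = refl
∑sptd-coeff j (suc n) = refl

theorem1 : (k : ℕ) → .{{_ : NonZero k}} → ∑sptd k ≈ P k * ⟨ - q ⁏q⟩∞ + (- 1#) ^ k * (⟨ q ⁏q⟩ pred k)
theorem1 (suc j) n = begin
  ∑sptd (suc j) n
    ≡⟨ ∑sptd-coeff j n ⟩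
  ℤ.+ sptd (suc j) n
    -- The bound `suc n` rather than `n` meets the strict inequality in `F-closed`.
    ≡⟨ cong ℤ.+_ (sptd-Sptd≤ j (ℕₚ.n≤1+n n)) ⟩
  ℤ.+ length (filter (λ π → sum π ≟ n) (Sptd≤ (suc j) (suc n)))
    ≡⟨ genFun-coeff (Sptd≤ (suc j) (suc n)) n ⟨
  F (suc j) (suc n) n
    ≡⟨ F-closed j (suc n) n ℕₚ.≤-refl ⟩
  closedForm j (⟨ - q ⁏q⟩ suc n) n
    -- Up to degree `n`, the product of the first `suc n` factors already has the coefficients of
    -- the infinite one.
    ≡⟨ cong (_+ᶻ ((- 1#) ^ suc j * (⟨ q ⁏q⟩ j)) n)
         (*-congˡ-below (P (suc j)) (λ i → qPochhammer-limit (- q) i (suc n)) n ℕₚ.≤-refl) ⟩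
  closedForm j ⟨ - q ⁏q⟩∞ n ∎
  where open ≡-Reasoning
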